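{- Let $k\ge1$ and let $g=\bigvee_{i=1}^k T_i$ be a unate DNF formula on $n$ variables in which every term $T_i$ is non-constant. Then, for $x$ uniform in $\{0,1\}^n$, $$\Pr_x\Big[(T_1(x)=1)\wedge\Big(\bigvee_{i=2}^kT_i(x)=0\Big)\Big]\ \le\ \Pr_x\Big[\bigvee_{i=1}^kT_i(x)=0\Big].$$
   Context: A term is an AND of literals, and a DNF formula is an OR of terms. A DNF formula is unate if it does not contain both a variable and its negation (anywhere in the formula). A term is non-constant if it contains at least one literal and does not contain both a variable and its negation. An empty OR is the constant $0$. -}

module Defs where

open import Data.Bool.Base using (Bool; true; false; not)
open import Data.Bool.ListAction using (all; any)
open import Data.Fin.Base using (Fin)
open import Data.Integer.Base using (+_)
open import Data.List.Base using (List; []; _∷_; _++_; map; filter; length)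
open import Data.List.Membership.Propositional using (_∈_)
open import Data.List.Relation.Unary.Any using (Any)
open import Data.Nat.Base using (ℕ; zero; suc; _^_)
open import Data.Nat.Properties using (m^n≢0)
open import Data.Product.Base using (_×_)
open import Data.Rational.Base using (ℚ; _/_)
open import Data.Vec.Base as Vec using (Vec; lookup)
open import Level using (Level)
open import Relation.Binary.PropositionalEquality.Core using (_≢_)
open import Relation.Nullary.Negation.Core using (¬_)
open import Relation.Unary using (Pred; Decidable)

private
  variable
    n : ℕ
    p : Level

data Literal (n : ℕ) : Set where
  pos : Fin n → Literal n
  neg : Fin n → Literal n

Term : ℕ → Set
Term n = List (Literal n)

DNF : ℕ → Set
DNF n = List (Term n)

evalLiteral : Literal n → Vec Bool n → Bool
evalLiteral (pos i) x = lookup x i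
evalLiteral (neg i) x = not (lookup x i)

evalTerm : Term n → Vec Bool n → Bool
evalTerm t x = all (λ l → evalLiteral l x) t

-- The empty disjunction evaluates to false.
evalDNF : DNF n → Vec Bool n → Bool
evalDNF g x = any (λ t → evalTerm t x) g

_occursIn_ : Literal n → DNF n → Set
l occursIn g = Any (l ∈_) g

-- The two literals of a variable may come from different terms.
Unate : DNF n → Set
Unate {n} g = (i : Fin n) → ¬ (pos i occursIn g × neg i occursIn g)

NonConstant : Term n → Set
NonConstant {n} t = t ≢ [] × ((i : Fin n) → ¬ (pos i ∈ t × neg i ∈ t))

-- Every point of {0,1}ⁿ is listed exactly once.
cube : (n : ℕ) → List (Vec Bool n)
cube zero    = Vec.[] ∷ []
cube (suc n) = map (false Vec.∷_) (cube n) ++ map (true Vec.∷_) (cube n)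

-- Probability of an event under the uniform distribution on {0,1}ⁿ.
Pr : {P : Pred (Vec Bool n) p} → Decidable P → ℚ
Pr {n} P? = _/_ (+ length (filter P? (cube n))) (2 ^ n) {{m^n≢0 2 n}}

{-# OPTIONS --safe #-}

-- Let l be a literal of T₁. Flipping the variable of l is a bijection of the
-- cube. If T₁ is true at x then so is l, so the flip makes l, hence T₁, false.
-- By unateness the negation of l does not occur in the formula, so the flip
-- cannot make any other term true.
module Submission where

open import Defs
open import Data.Bool.Base using (Bool; true; false; not; T; _∧_; _∨_)
open import Data.Bool.Properties using (_≟_; T-≡; ¬-not; ∧-conicalˡ)
open import Data.Fin.Base using (Fin; zero; suc)
import Data.Fin.Properties as Fin
import Data.Integer.Base as ℤ
import Data.Integer.Properties as ℤ
open import Data.List.Base using (List; []; _∷_; _++_; map; filter; length)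
open import Data.List.Membership.Propositional using (find; lose)
open import Data.List.Properties using (filter-++; length-++)
open import Data.List.Relation.Binary.Sublist.Propositional using (⊆-refl)
open import Data.List.Relation.Binary.Sublist.Propositional.Properties
  using (filter⁺; length-mono-≤)
open import Data.List.Relation.Unary.All as All using (All; _∷_)
open import Data.List.Relation.Unary.All.Properties using (all⁺; all⁻)
open import Data.List.Relation.Unary.Any using (here; there)
open import Data.List.Relation.Unary.Any.Properties using (any⁺; any⁻)
open import Data.Nat.Base as ℕ using (ℕ; suc; _^_)
import Data.Nat.Properties as ℕ
open import Data.Product.Base using (_×_; _,_)
open import Data.Rational.Base using (_≤_; _/_; toℚᵘ)
import Data.Rational.Properties as ℚ
import Data.Rational.Unnormalised.Base as ℚᵘ
import Data.Rational.Unnormalised.Properties as ℚᵘ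
open import Data.Sum.Base using (_⊎_; inj₁; inj₂)
open import Data.Vec.Base as Vec using (Vec; updateAt)
open import Data.Vec.Properties using (lookup∘updateAt; lookup∘updateAt′)
open import Function.Base using (_∘_)
open import Function.Bundles using (module Equivalence)
open import Level using (Level)
open import Relation.Binary.PropositionalEquality
  using (_≡_; _≢_; refl; trans; cong; cong₂; subst; module ≡-Reasoning)
open import Relation.Nullary.Decidable using (does; yes; no; _×-dec_)
open import Relation.Nullary.Negation.Core using (¬_; contradiction)
open import Relation.Unary using (Pred; Decidable; _⊆_)

private
  variable
    a p q : Level
    n : ℕ
    A B : Set a

/-monoˡ-≤ : ∀ {i j} d .{{_ : ℕ.NonZero d}} → i ℤ.≤ j → i / d ≤ j / d
/-monoˡ-≤ {i} {j} d@(suc d-1) i≤j = ℚ.toℚᵘ-cancel-≤ (begin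
  toℚᵘ (i / d)   ≃⟨ ℚ.toℚᵘ-fromℚᵘ (ℚᵘ.mkℚᵘ i d-1) ⟩
  ℚᵘ.mkℚᵘ i d-1  ≤⟨ ℚᵘ.*≤* (ℤ.*-monoʳ-≤-nonNeg (ℤ.+ d) i≤j) ⟩
  ℚᵘ.mkℚᵘ j d-1  ≃⟨ ℚ.toℚᵘ-fromℚᵘ (ℚᵘ.mkℚᵘ j d-1) ⟨
  toℚᵘ (j / d)   ∎)
  where open ℚᵘ.≤-Reasoning

length-filter-map : {P : Pred B p} (P? : Decidable P) (f : A → B) (xs : List A) →
  length (filter P? (map f xs)) ≡ length (filter (P? ∘ f) xs)
length-filter-map P? f []       = refl
length-filter-map P? f (x ∷ xs) with does (P? (f x))
... | true  = cong suc (length-filter-map P? f xs)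
... | false = length-filter-map P? f xs

length-filter-mono : {P : Pred A p} {Q : Pred A q}
  (P? : Decidable P) (Q? : Decidable Q) → P ⊆ Q → (xs : List A) →
  length (filter P? xs) ℕ.≤ length (filter Q? xs)
length-filter-mono P? Q? P⊆Q xs =
  length-mono-≤ (filter⁺ P? Q? (λ { refl → P⊆Q }) (⊆-refl {x = xs}))

count-cube-suc : {P : Pred (Vec Bool (suc n)) p} (P? : Decidable P) →
  length (filter P? (cube (suc n))) ≡
    length (filter (P? ∘ (false Vec.∷_)) (cube n)) ℕ.+
    length (filter (P? ∘ (true Vec.∷_)) (cube n))
count-cube-suc {n = n} P? = begin
  length (filter P? (map f (cube n) ++ map t (cube n)))
    ≡⟨ cong length (filter-++ P? (map f (cube n)) (map t (cube n))) ⟩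
  length (filter P? (map f (cube n)) ++ filter P? (map t (cube n)))
    ≡⟨ length-++ (filter P? (map f (cube n))) ⟩
  length (filter P? (map f (cube n))) ℕ.+ length (filter P? (map t (cube n)))
    ≡⟨ cong₂ ℕ._+_ (length-filter-map P? f (cube n)) (length-filter-map P? t (cube n)) ⟩
  length (filter (P? ∘ f) (cube n)) ℕ.+ length (filter (P? ∘ t) (cube n)) ∎
  where
  open ≡-Reasoning
  f = false Vec.∷_
  t = true Vec.∷_

flip : Fin n → Vec Bool n → Vec Bool n
flip i x = updateAt x i not

count-flip-≤ : {P : Pred (Vec Bool n) p} {Q : Pred (Vec Bool n) q}
  (P? : Decidable P) (Q? : Decidable Q) (i : Fin n) →
  (∀ x → P x → Q (flip i x)) →
  length (filter P? (cube n)) ℕ.≤ length (filter Q? (cube n))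
count-flip-≤ {n = suc n} P? Q? i P⇒Q
  rewrite count-cube-suc P? | count-cube-suc Q? with i
... | zero  = begin
  #P false ℕ.+ #P true
    ≤⟨ ℕ.+-mono-≤
         (length-filter-mono _ _ (λ {x} → P⇒Q (false Vec.∷ x)) (cube n))
         (length-filter-mono _ _ (λ {x} → P⇒Q (true Vec.∷ x)) (cube n)) ⟩
  #Q true ℕ.+ #Q false
    ≡⟨ ℕ.+-comm (#Q true) (#Q false) ⟩
  #Q false ℕ.+ #Q true ∎
  where
  open ℕ.≤-Reasoning
  #P #Q : Bool → ℕ
  #P b = length (filter (P? ∘ (b Vec.∷_)) (cube n))
  #Q b = length (filter (Q? ∘ (b Vec.∷_)) (cube n))
... | suc i = ℕ.+-mono-≤
  (count-flip-≤ (P? ∘ (false Vec.∷_)) (Q? ∘ (false Vec.∷_)) i (P⇒Q ∘ (false Vec.∷_)))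
  (count-flip-≤ (P? ∘ (true Vec.∷_)) (Q? ∘ (true Vec.∷_)) i (P⇒Q ∘ (true Vec.∷_)))

Pr-flip-≤ : {P : Pred (Vec Bool n) p} {Q : Pred (Vec Bool n) q}
  (P? : Decidable P) (Q? : Decidable Q) (i : Fin n) →
  (∀ x → P x → Q (flip i x)) → Pr P? ≤ Pr Q?
Pr-flip-≤ {n = n} P? Q? i P⇒Q =
  /-monoˡ-≤ (2 ^ n) {{ℕ.m^n≢0 2 n}} (ℤ.+≤+ (count-flip-≤ P? Q? i P⇒Q))

var : Literal n → Fin n
var (pos i) = i
var (neg i) = i

negate : Literal n → Literal n
negate (pos i) = neg i
negate (neg i) = pos i

var-injective : (l l′ : Literal n) → var l ≡ var l′ → l ≡ l′ ⊎ l ≡ negate l′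
var-injective (pos _) (pos _) refl = inj₁ refl
var-injective (pos _) (neg _) refl = inj₂ refl
var-injective (neg _) (pos _) refl = inj₂ refl
var-injective (neg _) (neg _) refl = inj₁ refl

evalLiteral-flip : (l : Literal n) (x : Vec Bool n) →
  evalLiteral l (flip (var l) x) ≡ not (evalLiteral l x)
evalLiteral-flip (pos i) x = lookup∘updateAt i x
evalLiteral-flip (neg i) x = cong not (lookup∘updateAt i x)

evalLiteral-flip-≢ : (l : Literal n) {i : Fin n} → var l ≢ i → (x : Vec Bool n) →
  evalLiteral l (flip i x) ≡ evalLiteral l x
evalLiteral-flip-≢ (pos j) j≢i x = lookup∘updateAt′ j _ j≢i x
evalLiteral-flip-≢ (neg j) j≢i x = cong not (lookup∘updateAt′ j _ j≢i x)

evalLiteral-flip⁻ : (l l′ : Literal n) (x : Vec Bool n) → T (evalLiteral l x) →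
  l′ ≢ negate l → T (evalLiteral l′ (flip (var l) x)) → T (evalLiteral l′ x)
evalLiteral-flip⁻ l l′ x l[x] l′≢¬l l′[y] with var l′ Fin.≟ var l
... | no  v≢ = subst T (evalLiteral-flip-≢ l′ v≢ x) l′[y]
... | yes v≡ with var-injective l′ l v≡
...   | inj₁ refl  = l[x]
...   | inj₂ l′≡¬l = contradiction l′≡¬l l′≢¬l

evalDNF-mono : (g : DNF n) {x y : Vec Bool n} →
  (∀ l → l occursIn g → T (evalLiteral l x) → T (evalLiteral l y)) →
  T (evalDNF g x) → T (evalDNF g y)
evalDNF-mono g x⇒y g[x] with find (any⁻ _ g g[x])
... | t , t∈g , t[x] = any⁺ _ (lose t∈g (all⁻ _ (All.tabulate λ {l} l∈t →
  x⇒y l (lose t∈g l∈t) (All.lookup (all⁺ _ t t[x]) l∈t))))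

unate-negate : {g : DNF n} → Unate g → (l : Literal n) →
  l occursIn g → ¬ (negate l occursIn g)
unate-negate unate (pos i) l∈g ¬l∈g = unate i (l∈g , ¬l∈g)
unate-negate unate (neg i) l∈g ¬l∈g = unate i (¬l∈g , l∈g)

falsify-by-flip : (l : Literal n) (t : Term n) (Ts : DNF n) → Unate ((l ∷ t) ∷ Ts) →
  ∀ x → evalTerm (l ∷ t) x ≡ true × evalDNF Ts x ≡ false →
  evalDNF ((l ∷ t) ∷ Ts) (flip (var l) x) ≡ false
falsify-by-flip l t Ts unate x (T₁[x] , ¬Ts[x]) =
  trans (cong (λ b → (b ∧ evalTerm t y) ∨ evalDNF Ts y) l[y]≡false)
    (¬-not λ Ts[y] →
      subst T ¬Ts[x] (evalDNF-mono Ts unflip (Equivalence.from T-≡ Ts[y])))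
  where
  y = flip (var l) x

  l[x]≡true : evalLiteral l x ≡ true
  l[x]≡true = ∧-conicalˡ (evalLiteral l x) (evalTerm t x) T₁[x]

  l[y]≡false : evalLiteral l y ≡ false
  l[y]≡false = trans (evalLiteral-flip l x) (cong not l[x]≡true)

  unflip : ∀ l′ → l′ occursIn Ts → T (evalLiteral l′ y) → T (evalLiteral l′ x)
  unflip l′ l′∈Ts = evalLiteral-flip⁻ l l′ x (Equivalence.from T-≡ l[x]≡true)
    λ { refl → unate-negate unate l (here (here refl)) (there l′∈Ts) }

lemma2p4 : (n : ℕ) (T₁ : Term n) (Ts : DNF n) →
    Unate (T₁ ∷ Ts) → All NonConstant (T₁ ∷ Ts) →
    Pr (λ x → (evalTerm T₁ x ≟ true) ×-dec (evalDNF Ts x ≟ false))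
    ≤ Pr (λ x → evalDNF (T₁ ∷ Ts) x ≟ false)
lemma2p4 n []      Ts unate ((T₁≢[] , _) ∷ _) = contradiction refl T₁≢[]
lemma2p4 n (l ∷ t) Ts unate _ =
  Pr-flip-≤ _ _ (var l) (falsify-by-flip l t Ts unate)
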